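{- Let $k, \ell \ge 1$ be fixed integers. If $G$ is a graph containing a clique of order $k$, then \[ \mathscr{I}(G) \le \frac{\alpha(G^{\Box \ell}\Box K_k)}{k|V(G)|^{\ell}}.\] Moreover, \[ \mathscr{I}(G) = \lim_{\ell \rightarrow \infty}\frac{\alpha(G^{\Box \ell}\Box K_k)}{k|V(G)|^{\ell}}.\]
   Context: All graphs are finite and simple. The Cartesian product $G \Box H$ has vertex set $V(G)\times V(H)$, with $(u,x)$ adjacent to $(v,y)$ if and only if either $u=v$ and $xy\in E(H)$, or $x=y$ and $uv\in E(G)$. Set $G^{\Box 1}=G$ and $G^{\Box k}=G^{\Box (k-1)}\Box G$ for $k\ge 2$. $\alpha(G)$ is the independence number of $G$, and $K_k$ is the complete graph on $k$ vertices. A clique of order $k$ is a set of $k$ pairwise adjacent vertices. The independence ratio is $i(G)=\alpha(G)/|V(G)|$, and the ultimate independence ratio is $\mathscr{I}(G)=\lim_{m\to\infty} i(G^{\Box m})$; this limit exists because $i(G^{\Box (m+1)})\le i(G^{\Box m})$ for all $m$. -}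

module Defs where

open import Data.Empty using (⊥-elim)
open import Data.Fin using (Fin)
import Data.Fin.Properties as Fin
open import Data.Fin.Subset using (Subset; _∈_; ∣_∣) renaming (⊥ to ∅)
open import Data.Fin.Subset.Properties using (_∈?_; anySubset?; ∣p∣≤n; ∣⊥∣≡0; ∉⊥)
open import Data.Integer using (+_)
open import Data.Nat using (ℕ; zero; suc; _*_; _^_; NonZero; >-nonZero; >-nonZero⁻¹)
  renaming (_≤_ to _≤ℕ_)
import Data.Nat.Properties as ℕ
open import Data.Product using (∃; _×_; _,_)
open import Data.Product.Function.NonDependent.Propositional using (_×-↔_)
open import Data.Rational using (ℚ; 0ℚ; 1ℚ; _<_; _+_; _-_; -_; _/_)
import Data.Rational.Properties as ℚ
open import Data.Sum using (_⊎_; inj₁; inj₂)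
open import Function using (_↔_; Inverse)
open import Function.Construct.Composition using (_↔-∘_)
open import Function.Construct.Identity using (↔-id)
open import Function.Construct.Symmetry using (↔-sym)
open import Function.Properties.Inverse using (↔⇒↣)
open import Level using (0ℓ)
open import Relation.Binary.Core using (Rel)
open import Relation.Binary.Definitions
  using (Decidable; DecidableEquality; Symmetric; Irreflexive; tri<; tri≈; tri>)
open import Relation.Binary.PropositionalEquality
  using (_≡_; _≢_; refl; sym; subst; ≢-sym)
open import Relation.Nullary using (¬_; yes; no; ¬?)
open import Relation.Nullary.Decidable using (_×-dec_; _⊎-dec_; _→-dec_)
import Relation.Unary as U

record Graph : Set₁ where
  field
    Vertex      : Set
    order       : ℕ
    enumerate   : Fin order ↔ Vertex
    Adj         : Rel Vertex 0ℓ
    adj?        : Decidable Adj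
    symmetric   : Symmetric Adj
    irreflexive : Irreflexive _≡_ Adj

  vertex : Fin order → Vertex
  vertex = Inverse.to enumerate

  _≟_ : DecidableEquality Vertex
  _≟_ = Fin.inj⇒≟ (↔⇒↣ (↔-sym enumerate))

open Graph using (order) public

complete : ℕ → Graph
complete k = record
  { Vertex      = Fin k
  ; order       = k
  ; enumerate   = ↔-id (Fin k)
  ; Adj         = _≢_
  ; adj?        = λ u v → ¬? (u Fin.≟ v)
  ; symmetric   = ≢-sym
  ; irreflexive = λ u≡v u≢v → u≢v u≡v
  }

infixl 6 _□_
infixl 7 _^□_

_□_ : Graph → Graph → Graph
G □ H = record
  { Vertex      = G.Vertex × H.Vertex
  ; order       = G.order * H.order
  ; enumerate   = (G.enumerate ×-↔ H.enumerate) ↔-∘ Fin.*↔×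
  ; Adj         = λ { (u , x) (v , y) → (u ≡ v × H.Adj x y) ⊎ (x ≡ y × G.Adj u v) }
  ; adj?        = λ { (u , x) (v , y) →
                      ((u G.≟ v) ×-dec H.adj? x y) ⊎-dec ((x H.≟ y) ×-dec G.adj? u v) }
  ; symmetric   = λ { (inj₁ (u≡v , xy)) → inj₁ (sym u≡v , H.symmetric xy)
                    ; (inj₂ (x≡y , uv)) → inj₂ (sym x≡y , G.symmetric uv) }
  ; irreflexive = λ { refl (inj₁ (_ , xx)) → H.irreflexive refl xx
                    ; refl (inj₂ (_ , uu)) → G.irreflexive refl uu }
  }
  where
  module G = Graph G
  module H = Graph H

-- Powers start at exponent 1; the value at 0 is only a totalisation and is
-- irrelevant to limits over the exponent.
_^□_ : Graph → ℕ → Graph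
G ^□ 0           = complete 1
G ^□ 1           = G
G ^□ suc (suc k) = (G ^□ suc k) □ G

-- A set of vertices is a subset of the indices in the enumeration of the vertices.
VertexSet : Graph → Set
VertexSet G = Subset (order G)

module _ (G : Graph) where
  open Graph G hiding (order)

  IsIndependent : VertexSet G → Set
  IsIndependent S = ∀ i j → i ∈ S → j ∈ S → ¬ Adj (vertex i) (vertex j)

  IsClique : VertexSet G → Set
  IsClique S = ∀ i j → i ∈ S → j ∈ S → i ≢ j → Adj (vertex i) (vertex j)

  HasClique : ℕ → Set
  HasClique k = ∃ λ S → IsClique S × ∣ S ∣ ≡ k

  HasIndependentSet : ℕ → Set
  HasIndependentSet a = ∃ λ S → IsIndependent S × ∣ S ∣ ≡ a

  independent? : U.Decidable IsIndependent
  independent? S = Fin.all? λ i → Fin.all? λ j →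
    (i ∈? S) →-dec ((j ∈? S) →-dec ¬? (adj? (vertex i) (vertex j)))

  hasIndependentSet? : U.Decidable HasIndependentSet
  hasIndependentSet? a = anySubset? λ S → independent? S ×-dec (∣ S ∣ ℕ.≟ a)

-- The greatest a ≤ n satisfying the predicate, or 0 if there is none.
greatest : {P : ℕ → Set} → U.Decidable P → ℕ → ℕ
greatest P? zero = zero
greatest P? (suc n) with P? (suc n)
... | yes _ = suc n
... | no  _ = greatest P? n

greatest-holds : {P : ℕ → Set} (P? : U.Decidable P) → P 0 → ∀ n → P (greatest P? n)
greatest-holds P? p₀ zero = p₀
greatest-holds P? p₀ (suc n) with P? (suc n)
... | yes p = p
... | no  _ = greatest-holds P? p₀ n

greatest-upper : {P : ℕ → Set} (P? : U.Decidable P) → ∀ n {a} → a ≤ℕ n → P a → a ≤ℕ greatest P? n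
greatest-upper P? zero a≤n _ = a≤n
greatest-upper P? (suc n) {a} a≤1+n p with P? (suc n)
... | yes _ = a≤1+n
... | no ¬p = greatest-upper P? n
  (ℕ.≤-pred (ℕ.≤∧≢⇒< a≤1+n (λ { refl → ¬p p }))) p

α : Graph → ℕ
α G = greatest (hasIndependentSet? G) (order G)

α-attained : ∀ G → HasIndependentSet G (α G)
α-attained G = greatest-holds (hasIndependentSet? G)
  (∅ , (λ _ _ i∈∅ → ⊥-elim (∉⊥ i∈∅)) , ∣⊥∣≡0 (order G)) (order G)

α-maximal : ∀ G {S} → IsIndependent G S → ∣ S ∣ ≤ℕ α G
α-maximal G {S} indep =
  greatest-upper (hasIndependentSet? G) (order G) (∣p∣≤n S) (S , indep , refl)

clique⇒nonEmpty : ∀ G {k} .{{_ : NonZero k}} → HasClique G k → NonZero (order G)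
clique⇒nonEmpty G {k} (S , _ , ∣S∣≡k) =
  >-nonZero (ℕ.≤-trans (>-nonZero⁻¹ k) (subst (_≤ℕ order G) ∣S∣≡k (∣p∣≤n S)))

^□-nonEmpty : ∀ G m .{{_ : NonZero (order G)}} → NonZero (order (G ^□ m))
^□-nonEmpty G 0             = _
^□-nonEmpty G 1             = >-nonZero (>-nonZero⁻¹ (order G))
^□-nonEmpty G (suc (suc m)) = ℕ.m*n≢0 _ _ {{^□-nonEmpty G (suc m)}}

independenceRatio : (G : Graph) .{{_ : NonZero (order G)}} → ℚ
independenceRatio G = + α G / order G

cliqueProductRatio : (G : Graph) (k ℓ : ℕ) .{{_ : NonZero k}} .{{_ : NonZero (order G)}} → ℚ
cliqueProductRatio G k ℓ {{k≢0}} = + α (G ^□ ℓ □ complete k) / (k * order G ^ ℓ)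
  where instance
  denominator-nonZero : NonZero (k * order G ^ ℓ)
  denominator-nonZero = ℕ.m*n≢0 k (order G ^ ℓ) {{k≢0}} {{ℕ.m^n≢0 (order G) ℓ}}

-- Dedekind reals: below q means q < x, above q means x < q.
record ℝ : Set₁ where
  field
    below above     : ℚ → Set
    below-inhabited : ∃ below
    above-inhabited : ∃ above
    below-closed    : ∀ {p q} → p < q → below q → below p
    above-closed    : ∀ {p q} → p < q → above p → above q
    below-open      : ∀ {p} → below p → ∃ λ q → p < q × below q
    above-open      : ∀ {q} → above q → ∃ λ p → p < q × above p
    disjoint        : ∀ {q} → ¬ (below q × above q)
    located         : ∀ {p q} → p < q → below p ⊎ above q

open ℝ using (below; above) public

infix 4 _≤_ _⟶_

_≤_ : ℝ → ℝ → Set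
x ≤ y = ∀ q → below x q → below y q

fromℚ : ℚ → ℝ
fromℚ r = record
  { below           = _< r
  ; above           = r <_
  ; below-inhabited = r - 1ℚ , subst (r - 1ℚ <_) (ℚ.+-identityʳ r) (ℚ.+-monoʳ-< r (ℚ.negative⁻¹ (- 1ℚ)))
  ; above-inhabited = r + 1ℚ , subst (_< r + 1ℚ) (ℚ.+-identityʳ r) (ℚ.+-monoʳ-< r (ℚ.positive⁻¹ 1ℚ))
  ; below-closed    = ℚ.<-trans
  ; above-closed    = λ p<q r<p → ℚ.<-trans r<p p<q
  ; below-open      = λ p<r → let (q , p<q , q<r) = ℚ.<-dense p<r in q , p<q , q<r
  ; above-open      = λ r<q → let (p , r<p , p<q) = ℚ.<-dense r<q in p , p<q , r<p
  ; disjoint        = λ (q<r , r<q) → ℚ.<-asym q<r r<q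
  ; located         = located
  }
  where
  located : ∀ {p q} → p < q → p < r ⊎ r < q
  located {p} p<q with ℚ.<-cmp p r
  ... | tri< p<r _    _   = inj₁ p<r
  ... | tri≈ _   refl _   = inj₂ p<q
  ... | tri> _   _    r<p = inj₂ (ℚ.<-trans r<p p<q)

-- The body says a n - ε < x < a n + ε, that is, ∣ a n - x ∣ < ε.
_⟶_ : (ℕ → ℚ) → ℝ → Set
a ⟶ x = ∀ ε → 0ℚ < ε → ∃ λ N → ∀ n → N ≤ℕ n → below x (a n - ε) × above x (a n + ε)

IsUltimateIndependenceRatio : (G : Graph) .{{_ : NonZero (order G)}} → ℝ → Set
IsUltimateIndependenceRatio G x = (λ m → independenceRatio (G ^□ m) {{^□-nonEmpty G m}}) ⟶ x

module Submission where

-- Write i_p and r_p for the two ratios at exponent p, and n = |V(G)|. Splitting an independent set of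
-- G^{p+1} = G^p □ G into its fibres over the last factor, and grouping the fibres over the k-clique,
-- gives α(G^{p+1}) ≤ α(G^p □ K_k) + (n - k) α(G^p), that is n i_{p+1} ≤ k r_p + (n - k) i_p. Since also
-- r_p ≤ i_p, the convergence of i_p forces r_p to the same limit; as r_p is nonincreasing, it bounds
-- the limit from above.

open import Defs
open import Data.Bool using (Bool; true; false; if_then_else_)
open import Data.Fin using (Fin; zero; suc; combine; _↑ˡ_; _↑ʳ_)
import Data.Fin.Properties as Fin
open import Data.Fin.Subset using (Subset; _∈_; ∣_∣; ∁; inside; outside)
open import Data.Fin.Subset.Properties using (∣∁p∣≡n∸∣p∣; ∣p∣≤n)
open import Data.Integer using (+_)
import Data.Integer as ℤ
import Data.Integer.Properties as ℤ
open import Data.Nat using (ℕ; zero; suc; _^_; NonZero; z≤n; s≤s)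
  renaming (_+_ to _+ℕ_; _*_ to _*ℕ_; _∸_ to _∸ℕ_; _≤_ to _≤ℕ_)
import Data.Nat.Properties as ℕ
open import Data.Product using (∃; _×_; _,_; proj₁; proj₂)
open import Data.Rational
  using (ℚ; _/_; _+_; _*_; _-_; -_; 0ℚ; toℚᵘ; NonNegative; Positive; positive; nonNegative)
  renaming (_≤_ to _≤ℚ_; _<_ to _<ℚ_)
import Data.Rational.Properties as ℚ
open import Data.Rational.Solver using (module +-*-Solver)
open import Data.Rational.Unnormalised using (mkℚᵘ; *≤*)
import Data.Rational.Unnormalised as ℚᵘ
import Data.Rational.Unnormalised.Properties as ℚᵘ
open import Data.Sum using (inj₁; inj₂)
open import Data.Vec using ([]; _∷_; lookup; tabulate; here; there)
open import Data.Vec.Properties using (lookup∘tabulate; tabulate∘lookup; []=⇒lookup; lookup⇒[]=)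
open import Function using (_∘_; Inverse; it)
open import Relation.Binary.Definitions using (tri<; tri≈; tri>)
open import Relation.Binary.PropositionalEquality
  using (_≡_; _≢_; refl; sym; trans; cong; cong₂; subst; subst₂; module ≡-Reasoning)
open import Relation.Nullary using (¬_; contradiction)
open import Algebra.Properties.CommutativeMonoid.Sum ℕ.+-0-commutativeMonoid using (sum; sum-cong-≗; ∑-comm)

open Graph using (Vertex; Adj; vertex; enumerate)

-- Finite sums, and the elements of a subset as a list.

sum-≤-const : ∀ {n c} (f : Fin n → ℕ) → (∀ i → f i ≤ℕ c) → sum f ≤ℕ n *ℕ c
sum-≤-const {zero}  f f≤c = z≤n
sum-≤-const {suc n} f f≤c = ℕ.+-mono-≤ (f≤c zero) (sum-≤-const (f ∘ suc) (f≤c ∘ suc))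

sum-++ : ∀ m {n} (f : Fin (m +ℕ n) → ℕ) → sum f ≡ sum (f ∘ (_↑ˡ n)) +ℕ sum (f ∘ (m ↑ʳ_))
sum-++ zero    f = refl
sum-++ (suc m) f = trans (cong (f zero +ℕ_) (sum-++ m (f ∘ suc))) (sym (ℕ.+-assoc (f zero) _ _))

sum-combine : ∀ m n (f : Fin (m *ℕ n) → ℕ) → sum f ≡ sum λ i → sum λ j → f (combine {m} {n} i j)
sum-combine zero    n f = refl
sum-combine (suc m) n f = trans (sum-++ n f) (cong (sum (f ∘ (_↑ˡ m *ℕ n)) +ℕ_) (sum-combine m n (f ∘ (n ↑ʳ_))))

-- Listing the elements in increasing order turns a clique, given as a subset, into a map out of
-- `complete ∣ S ∣`.
embed : ∀ {n} (S : Subset n) → Fin ∣ S ∣ → Fin n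
embed (inside  ∷ S) zero    = zero
embed (inside  ∷ S) (suc j) = suc (embed S j)
embed (outside ∷ S) j       = suc (embed S j)

embed-∈ : ∀ {n} (S : Subset n) j → embed S j ∈ S
embed-∈ (inside  ∷ S) zero    = here
embed-∈ (inside  ∷ S) (suc j) = there (embed-∈ S j)
embed-∈ (outside ∷ S) j       = there (embed-∈ S j)

embed-injective : ∀ {n} (S : Subset n) {i j} → embed S i ≡ embed S j → i ≡ j
embed-injective (inside  ∷ S) {zero}  {zero}  _  = refl
embed-injective (inside  ∷ S) {suc i} {suc j} eq = cong suc (embed-injective S (Fin.suc-injective eq))
embed-injective (outside ∷ S) eq = embed-injective S (Fin.suc-injective eq)

-- Terms indexed by `S` are kept exactly and only the others are replaced by `c`. With `S` a clique,
-- the kept terms can later be estimated jointly.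
sum-≤-embed : ∀ {n c} (S : Subset n) (f : Fin n → ℕ) → (∀ i → f i ≤ℕ c) →
              sum f ≤ℕ sum (f ∘ embed S) +ℕ ∣ ∁ S ∣ *ℕ c
sum-≤-embed [] f f≤c = z≤n
sum-≤-embed {c = c} (inside ∷ S) f f≤c = begin
  f zero +ℕ sum (f ∘ suc)                                 ≤⟨ ℕ.+-monoʳ-≤ (f zero) (sum-≤-embed S (f ∘ suc) (f≤c ∘ suc)) ⟩
  f zero +ℕ (sum (f ∘ suc ∘ embed S) +ℕ ∣ ∁ S ∣ *ℕ c)     ≡⟨ ℕ.+-assoc (f zero) _ _ ⟨
  f zero +ℕ sum (f ∘ suc ∘ embed S) +ℕ ∣ ∁ S ∣ *ℕ c       ∎
  where open ℕ.≤-Reasoning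
sum-≤-embed {c = c} (outside ∷ S) f f≤c = begin
  f zero +ℕ sum (f ∘ suc)             ≤⟨ ℕ.+-mono-≤ (f≤c zero) (sum-≤-embed S (f ∘ suc) (f≤c ∘ suc)) ⟩
  c +ℕ (e +ℕ ∣ ∁ S ∣ *ℕ c)            ≡⟨ ℕ.+-assoc c e _ ⟨
  c +ℕ e +ℕ ∣ ∁ S ∣ *ℕ c              ≡⟨ cong (_+ℕ ∣ ∁ S ∣ *ℕ c) (ℕ.+-comm c e) ⟩
  e +ℕ c +ℕ ∣ ∁ S ∣ *ℕ c              ≡⟨ ℕ.+-assoc e c _ ⟩
  e +ℕ (c +ℕ ∣ ∁ S ∣ *ℕ c)            ∎
  where
  open ℕ.≤-Reasoning
  e = sum (f ∘ suc ∘ embed S)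

-- Counting vertices and independent sets.

indicator : Bool → ℕ
indicator b = if b then 1 else 0

∣tabulate∣ : ∀ {n} (s : Fin n → Bool) → ∣ tabulate s ∣ ≡ sum (indicator ∘ s)
∣tabulate∣ {zero}  s = refl
∣tabulate∣ {suc n} s with s zero
... | true  = cong suc (∣tabulate∣ (s ∘ suc))
... | false = ∣tabulate∣ (s ∘ suc)

sumᵛ : (G : Graph) → (Vertex G → ℕ) → ℕ
sumᵛ G f = sum (f ∘ vertex G)

sumᵛ-cong : ∀ G {f g : Vertex G → ℕ} → (∀ v → f v ≡ g v) → sumᵛ G f ≡ sumᵛ G g
sumᵛ-cong G f≗g = sum-cong-≗ (f≗g ∘ vertex G)

sumᵛ-≤-const : ∀ G {c} {f : Vertex G → ℕ} → (∀ v → f v ≤ℕ c) → sumᵛ G f ≤ℕ order G *ℕ c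
sumᵛ-≤-const G f≤c = sum-≤-const {order G} _ (f≤c ∘ vertex G)

sumᵛ-comm : ∀ G H (f : Vertex G → Vertex H → ℕ) →
            (sumᵛ G λ u → sumᵛ H λ x → f u x) ≡ (sumᵛ H λ x → sumᵛ G λ u → f u x)
sumᵛ-comm G H f = ∑-comm λ i j → f (vertex G i) (vertex H j)

-- The product is enumerated through the inverse of `combine`, so the sum becomes an iterated one.
-- The second factor is put outermost so that the inner sums run over fibres, which are copies of
-- `G`.
sumᵛ-□ : ∀ G H (f : Vertex (G □ H) → ℕ) → sumᵛ (G □ H) f ≡ (sumᵛ H λ x → sumᵛ G λ u → f (u , x))
sumᵛ-□ G H f = begin
  sumᵛ (G □ H) f                                          ≡⟨ sum-combine (order G) (order H) (f ∘ vertex (G □ H)) ⟩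
  (sum λ i → sum λ j → f (vertex (G □ H) (combine {order G} {order H} i j)))
    ≡⟨ sum-cong-≗ {order G} (λ i → sum-cong-≗ {order H} λ j →
         cong (λ (i , j) → f (vertex G i , vertex H j)) (Fin.remQuot-combine i j)) ⟩
  (sumᵛ G λ u → sumᵛ H λ x → f (u , x))                   ≡⟨ sumᵛ-comm G H (λ u x → f (u , x)) ⟩
  (sumᵛ H λ x → sumᵛ G λ u → f (u , x))                   ∎
  where open ≡-Reasoning

-- Predicates on vertices, rather than subsets of indices, make restriction to a fibre or a subgraph
-- mere composition.
Independent : (G : Graph) → (Vertex G → Bool) → Set
Independent G s = ∀ {u v} → s u ≡ true → s v ≡ true → ¬ Adj G u v

independent⇒size≤α : ∀ G {s} → Independent G s → sumᵛ G (indicator ∘ s) ≤ℕ α G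
independent⇒size≤α G {s} ind = subst (_≤ℕ α G) (∣tabulate∣ (s ∘ vertex G))
  (α-maximal G λ i j i∈ j∈ → ind (selected i i∈) (selected j j∈))
  where
  selected : ∀ i → i ∈ tabulate (s ∘ vertex G) → s (vertex G i) ≡ true
  selected i i∈ = trans (sym (lookup∘tabulate (s ∘ vertex G) i)) ([]=⇒lookup i∈)

-- A largest independent set, read as a predicate through the inverse of the enumeration, is one of
-- the sets that the bound covers.
α-least : ∀ G {b} → (∀ s → Independent G s → sumᵛ G (indicator ∘ s) ≤ℕ b) → α G ≤ℕ b
α-least G {b} bound with α-attained G
... | S , indS , ∣S∣≡α = subst (_≤ℕ b) size (bound (lookup S ∘ index) ind)
  where
  index = Inverse.from (enumerate G)

  ind : Independent G (lookup S ∘ index)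
  ind {u} {v} su sv uv = indS (index u) (index v) (lookup⇒[]= _ S su) (lookup⇒[]= _ S sv)
    (subst (λ w → Adj G w (vertex G (index v))) (sym (Inverse.strictlyInverseˡ (enumerate G) u))
      (subst (Adj G u) (sym (Inverse.strictlyInverseˡ (enumerate G) v)) uv))

  size : sumᵛ G (indicator ∘ lookup S ∘ index) ≡ α G
  size = trans (sum-cong-≗ λ i → cong (indicator ∘ lookup S) (Inverse.strictlyInverseʳ (enumerate G) i))
    (trans (sym (∣tabulate∣ (lookup S))) (trans (cong ∣_∣ (tabulate∘lookup S)) ∣S∣≡α))

-- The preimage of an independent set under a map preserving adjacency is independent. All bounds on
-- products below come from suitable choices of `φ`.
pullback-size≤α : ∀ H G {s} (φ : Vertex H → Vertex G) → (∀ {u v} → Adj H u v → Adj G (φ u) (φ v)) →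
                  Independent G s → sumᵛ H (indicator ∘ s ∘ φ) ≤ℕ α H
pullback-size≤α H G φ hom ind = independent⇒size≤α H λ su sv uv → ind su sv (hom uv)

-- Upper bounds on the independence number of products.

fibre-size≤α : ∀ G H {s} → Independent (G □ H) s → ∀ x → (sumᵛ G λ u → indicator (s (u , x))) ≤ℕ α G
fibre-size≤α G H ind x = pullback-size≤α G (G □ H) (_, x) (λ uv → inj₂ (refl , uv)) ind

-- There are `order H` fibres, each contributing at most `α G`. With `H` complete this yields r_p ≤
-- i_p.
α-□-≤ : ∀ G H → α (G □ H) ≤ℕ order H *ℕ α G
α-□-≤ G H = α-least (G □ H) λ s ind → begin
  sumᵛ (G □ H) (indicator ∘ s)                              ≡⟨ sumᵛ-□ G H (indicator ∘ s) ⟩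
  (sumᵛ H λ x → sumᵛ G λ u → indicator (s (u , x)))         ≤⟨ sumᵛ-≤-const H (fibre-size≤α G H ind) ⟩
  order H *ℕ α G                                            ∎
  where open ℕ.≤-Reasoning

-- Fixing the middle coordinate cuts the product into `order H` copies of `G □ F`. With `F` complete
-- this makes r_p nonincreasing.
α-□-□-≤ : ∀ G H F → α (G □ H □ F) ≤ℕ order H *ℕ α (G □ F)
α-□-□-≤ G H F = α-least (G □ H □ F) λ s ind → begin
  sumᵛ (G □ H □ F) (indicator ∘ s)
    ≡⟨ sumᵛ-□ (G □ H) F (indicator ∘ s) ⟩
  (sumᵛ F λ y → sumᵛ (G □ H) λ w → indicator (s (w , y)))
    ≡⟨ sumᵛ-cong F (λ y → sumᵛ-□ G H λ w → indicator (s (w , y))) ⟩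
  (sumᵛ F λ y → sumᵛ H λ x → sumᵛ G λ u → indicator (s ((u , x) , y)))
    ≡⟨ sumᵛ-comm F H (λ y x → sumᵛ G λ u → indicator (s ((u , x) , y))) ⟩
  (sumᵛ H λ x → sumᵛ F λ y → sumᵛ G λ u → indicator (s ((u , x) , y)))
    ≡⟨ sumᵛ-cong H (λ x → sumᵛ-□ G F λ (u , y) → indicator (s ((u , x) , y))) ⟨
  (sumᵛ H λ x → sumᵛ (G □ F) λ (u , y) → indicator (s ((u , x) , y)))
    ≤⟨ sumᵛ-≤-const H (λ x → pullback-size≤α (G □ F) (G □ H □ F) (λ (u , y) → (u , x) , y)
         (λ { (inj₁ (refl , yz)) → inj₁ (refl , yz) ; (inj₂ (refl , uv)) → inj₂ (refl , inj₂ (refl , uv)) }) ind) ⟩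
  order H *ℕ α (G □ F)
    ∎
  where open ℕ.≤-Reasoning

-- The fibres over the clique together form an independent set of `G □ complete k`, because distinct
-- clique vertices are adjacent in `H`. Each of the remaining fibres contributes at most `α G`.
α-□-clique-≤ : ∀ G H {k} → HasClique H k → α (G □ H) ≤ℕ α (G □ complete k) +ℕ (order H ∸ℕ k) *ℕ α G
α-□-clique-≤ G H (C , clique , refl) = α-least (G □ H) λ s ind → begin
  sumᵛ (G □ H) (indicator ∘ s)
    ≡⟨ sumᵛ-□ G H (indicator ∘ s) ⟩
  (sumᵛ H λ x → sumᵛ G λ u → indicator (s (u , x)))
    ≤⟨ sum-≤-embed C _ (fibre-size≤α G H ind ∘ vertex H) ⟩
  (sumᵛ K λ j → sumᵛ G λ u → indicator (s (u , c j))) +ℕ ∣ ∁ C ∣ *ℕ α G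
    ≡⟨ cong₂ (λ m n → m +ℕ n *ℕ α G) (sym (sumᵛ-□ G K λ (u , j) → indicator (s (u , c j)))) (∣∁p∣≡n∸∣p∣ C) ⟩
  (sumᵛ (G □ K) λ (u , j) → indicator (s (u , c j))) +ℕ (order H ∸ℕ ∣ C ∣) *ℕ α G
    ≤⟨ ℕ.+-monoˡ-≤ _ (pullback-size≤α (G □ K) (G □ H) (λ (u , j) → u , c j)
         (λ { (inj₁ (refl , i≢j)) → inj₁ (refl , c-adj i≢j) ; (inj₂ (refl , uv)) → inj₂ (refl , uv) }) ind) ⟩
  α (G □ K) +ℕ (order H ∸ℕ ∣ C ∣) *ℕ α G
    ∎
  where
  open ℕ.≤-Reasoning
  K = complete ∣ C ∣

  c : Fin ∣ C ∣ → Vertex H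
  c = vertex H ∘ embed C

  c-adj : ∀ {i j} → i ≢ j → Adj H (c i) (c j)
  c-adj i≢j = clique _ _ (embed-∈ C _) (embed-∈ C _) (i≢j ∘ embed-injective C)

-- Fractions of natural numbers in the rationals.

+/-mono-≤ : ∀ a b d e .{{_ : NonZero d}} .{{_ : NonZero e}} → a *ℕ e ≤ℕ b *ℕ d → + a / d ≤ℚ + b / e
-- The fractions are stored in lowest terms, so cross-multiplication is done on their unnormalised
-- representatives.
+/-mono-≤ a b (suc d) (suc e) ae≤bd = ℚ.toℚᵘ-cancel-≤
  (ℚᵘ.≤-respˡ-≃ (ℚᵘ.≃-sym (ℚ.toℚᵘ-fromℚᵘ (mkℚᵘ (+ a) d)))
    (ℚᵘ.≤-respʳ-≃ (ℚᵘ.≃-sym (ℚ.toℚᵘ-fromℚᵘ (mkℚᵘ (+ b) e)))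
      (*≤* (subst₂ ℤ._≤_ (ℤ.pos-* a (suc e)) (ℤ.pos-* b (suc d)) (ℤ.+≤+ ae≤bd)))))

+/-≡ : ∀ a b d e .{{_ : NonZero d}} .{{_ : NonZero e}} → a *ℕ e ≡ b *ℕ d → + a / d ≡ + b / e
+/-≡ a b d e eq = ℚ.≤-antisym (+/-mono-≤ a b d e (ℕ.≤-reflexive eq)) (+/-mono-≤ b a e d (ℕ.≤-reflexive (sym eq)))

+/-* : ∀ a b d e .{{_ : NonZero d}} .{{_ : NonZero e}} .{{_ : NonZero (d *ℕ e)}} →
       (+ a / d) * (+ b / e) ≡ + (a *ℕ b) / (d *ℕ e)
+/-* a b (suc d) (suc e) = ℚ.toℚᵘ-injective (begin-equality
  toℚᵘ ((+ a / suc d) * (+ b / suc e))              ≃⟨ ℚ.toℚᵘ-homo-* (+ a / suc d) (+ b / suc e) ⟩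
  toℚᵘ (+ a / suc d) ℚᵘ.* toℚᵘ (+ b / suc e)        ≃⟨ ℚᵘ.*-cong (ℚ.toℚᵘ-fromℚᵘ (mkℚᵘ (+ a) d)) (ℚ.toℚᵘ-fromℚᵘ (mkℚᵘ (+ b) e)) ⟩
  mkℚᵘ (+ a) d ℚᵘ.* mkℚᵘ (+ b) e                    ≡⟨ cong (ℚᵘ._/ (suc d *ℕ suc e)) (ℤ.pos-* a b) ⟨
  mkℚᵘ (+ (a *ℕ b)) (e +ℕ d *ℕ suc e)               ≃⟨ ℚ.toℚᵘ-fromℚᵘ (mkℚᵘ (+ (a *ℕ b)) (e +ℕ d *ℕ suc e)) ⟨
  toℚᵘ (+ (a *ℕ b) / (suc d *ℕ suc e))              ∎)
  where open ℚᵘ.≤-Reasoning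

ι : ℕ → ℚ
ι n = + n / 1

ι-mono-≤ : ∀ {m n} → m ≤ℕ n → ι m ≤ℚ ι n
ι-mono-≤ {m} {n} m≤n = +/-mono-≤ m n 1 1 (ℕ.*-monoˡ-≤ 1 m≤n)

ι-nonNeg : ∀ n → NonNegative (ι n)
ι-nonNeg n = ℚ.normalize-nonNeg n 1

ι-pos : ∀ n .{{_ : NonZero n}} → Positive (ι n)
ι-pos n = ℚ.normalize-pos n 1

ι-* : ∀ m n → ι (m *ℕ n) ≡ ι m * ι n
ι-* m n = sym (+/-* m n 1 1)

ι-+ : ∀ m n → ι (m +ℕ n) ≡ ι m + ι n
ι-+ m n = ℚ.toℚᵘ-injective (begin-equality
  toℚᵘ (ι (m +ℕ n))             ≃⟨ ℚ.toℚᵘ-fromℚᵘ (mkℚᵘ (+ (m +ℕ n)) 0) ⟩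
  mkℚᵘ (+ (m +ℕ n)) 0           ≡⟨ cong (λ i → mkℚᵘ i 0) (cong₂ ℤ._+_ (ℤ.*-identityʳ (+ m)) (ℤ.*-identityʳ (+ n))) ⟨
  mkℚᵘ (+ m) 0 ℚᵘ.+ mkℚᵘ (+ n) 0
    ≃⟨ ℚᵘ.+-cong (ℚ.toℚᵘ-fromℚᵘ (mkℚᵘ (+ m) 0)) (ℚ.toℚᵘ-fromℚᵘ (mkℚᵘ (+ n) 0)) ⟨
  toℚᵘ (ι m) ℚᵘ.+ toℚᵘ (ι n)    ≃⟨ ℚ.toℚᵘ-homo-+ (ι m) (ι n) ⟨
  toℚᵘ (ι m + ι n)              ∎)
  where open ℚᵘ.≤-Reasoning

ι-*-/ : ∀ a d .{{_ : NonZero d}} → ι d * (+ a / d) ≡ ι a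
ι-*-/ a d@(suc _) = trans (+/-* d a 1 d) (+/-≡ (d *ℕ a) a (1 *ℕ d) 1 eq)
  where
  eq : d *ℕ a *ℕ 1 ≡ a *ℕ (1 *ℕ d)
  eq = trans (ℕ.*-identityʳ (d *ℕ a)) (trans (ℕ.*-comm d a) (cong (a *ℕ_) (sym (ℕ.*-identityˡ d))))

-- Rational estimates from the counting bounds.

open +-*-Solver using (solve; _:+_; _:*_; _:-_; _:=_)

-- This is the counting bound divided by `d`: multiplying by `ι d` clears every denominator. In the
-- application `d` is the order of a power of the graph and `n` the order of the graph.
quotient-recurrence : ∀ {a a′ b} c k n d .{{_ : NonZero d}} .{{_ : NonZero (k *ℕ d)}} .{{_ : NonZero (d *ℕ n)}} →
  a′ ≤ℕ b +ℕ c *ℕ a → ι n * (+ a′ / (d *ℕ n)) ≤ℚ ι k * (+ b / (k *ℕ d)) + ι c * (+ a / d)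
quotient-recurrence {a} {a′} {b} c k n d a′≤ = ℚ.*-cancelˡ-≤-pos (ι d) {{ι-pos d}} (begin
  ι d * (ι n * y)                   ≡⟨ ℚ.*-assoc (ι d) (ι n) y ⟨
  ι d * ι n * y                     ≡⟨ cong (_* y) (ι-* d n) ⟨
  ι (d *ℕ n) * y                    ≡⟨ ι-*-/ a′ (d *ℕ n) ⟩
  ι a′                              ≤⟨ ι-mono-≤ a′≤ ⟩
  ι (b +ℕ c *ℕ a)                   ≡⟨ trans (ι-+ b (c *ℕ a)) (cong (λ z → ι b + z) (ι-* c a)) ⟩
  ι b + ι c * ι a                   ≡⟨ cong₂ (λ p q → p + ι c * q) (ι-*-/ b (k *ℕ d)) (ι-*-/ a d) ⟨
  ι (k *ℕ d) * r + ι c * (ι d * x)  ≡⟨ cong (λ p → p * r + ι c * (ι d * x)) (ι-* k d) ⟩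
  ι k * ι d * r + ι c * (ι d * x)
    ≡⟨ solve 5 (λ K D R C X → K :* D :* R :+ C :* (D :* X) := D :* (K :* R :+ C :* X)) refl (ι k) (ι d) r (ι c) x ⟩
  ι d * (ι k * r + ι c * x)         ∎)
  where
  open ℚ.≤-Reasoning
  x = + a / d
  y = + a′ / (d *ℕ n)
  r = + b / (k *ℕ d)

-- The factor 2(k + c) bounds (k + 2c) / k, since k ≥ 1.
slack-estimate : ∀ k c {x y r δ} .{{_ : NonZero k}} → 0ℚ ≤ℚ δ → x - δ ≤ℚ y + δ →
  ι (k +ℕ c) * y ≤ℚ ι k * r + ι c * x → y + δ ≤ℚ r + ι (2 *ℕ (k +ℕ c)) * δ
slack-estimate k c {x} {y} {r} {δ} 0≤δ x-δ≤y+δ ny≤ = ℚ.*-cancelˡ-≤-pos K {{ι-pos k}} (begin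
  K * (y + δ)
    ≡⟨ solve 4 (λ K C Y D → K :* (Y :+ D) := (K :+ C) :* Y :+ (K :* D :- C :* Y)) refl K C y δ ⟩
  (K + C) * y + (K * δ - C * y)
    ≡⟨ cong (λ z → z * y + (K * δ - C * y)) (ι-+ k c) ⟨
  ι (k +ℕ c) * y + (K * δ - C * y)
    ≤⟨ ℚ.+-monoˡ-≤ (K * δ - C * y) ny≤ ⟩
  K * r + C * x + (K * δ - C * y)
    ≡⟨ solve 6 (λ K C R X Y D → K :* R :+ C :* X :+ (K :* D :- C :* Y)
                := C :* (X :- D) :+ (K :* R :+ (K :+ C) :* D :- C :* Y)) refl K C r x y δ ⟩
  C * (x - δ) + (K * r + (K + C) * δ - C * y)
    -- Replacing `x - δ` by `y + δ` leaves `C * y` with both signs, so `y` cancels.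
    ≤⟨ ℚ.+-monoˡ-≤ (K * r + (K + C) * δ - C * y) (ℚ.*-monoˡ-≤-nonNeg C {{ι-nonNeg c}} x-δ≤y+δ) ⟩
  C * (y + δ) + (K * r + (K + C) * δ - C * y)
    ≡⟨ solve 5 (λ K C R Y D → C :* (Y :+ D) :+ (K :* R :+ (K :+ C) :* D :- C :* Y)
                := K :* R :+ (K :+ C :+ C) :* D) refl K C r y δ ⟩
  K * r + (K + C + C) * δ
    ≡⟨ cong (λ z → K * r + z * δ) (trans (ι-+ (k +ℕ c) c) (cong (λ z → z + C) (ι-+ k c))) ⟨
  K * r + ι (k +ℕ c +ℕ c) * δ
    ≤⟨ ℚ.+-monoʳ-≤ (K * r) (ℚ.*-monoʳ-≤-nonNeg δ {{nonNegative 0≤δ}} (ι-mono-≤ k+2c≤)) ⟩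
  K * r + ι (k *ℕ (2 *ℕ (k +ℕ c))) * δ
    ≡⟨ cong (λ z → K * r + z * δ) (ι-* k (2 *ℕ (k +ℕ c))) ⟩
  K * r + K * M * δ
    ≡⟨ solve 4 (λ K M R D → K :* R :+ K :* M :* D := K :* (R :+ M :* D)) refl K M r δ ⟩
  K * (r + M * δ)
    ∎)
  where
  open ℚ.≤-Reasoning
  K = ι k
  C = ι c
  M = ι (2 *ℕ (k +ℕ c))

  k+2c≤ : k +ℕ c +ℕ c ≤ℕ k *ℕ (2 *ℕ (k +ℕ c))
  k+2c≤ = ℕ.≤-trans
    (ℕ.+-monoʳ-≤ (k +ℕ c) (ℕ.≤-trans (ℕ.m≤n+m c k) (ℕ.m≤m+n (k +ℕ c) 0)))
    (ℕ.m≤n*m (2 *ℕ (k +ℕ c)) k)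

-- Dedekind cuts and limits.

above-upward : ∀ (ℐ : ℝ) {p q} → p ≤ℚ q → above ℐ p → above ℐ q
above-upward ℐ {p} {q} p≤q ℐ<p with ℚ.<-cmp p q
... | tri< p<q _ _  = ℝ.above-closed ℐ p<q ℐ<p
... | tri≈ _ refl _ = ℐ<p
... | tri> _ _ q<p  = contradiction (ℚ.<-≤-trans q<p p≤q) (ℚ.<-irrefl refl)

below-downward : ∀ (ℐ : ℝ) {p q} → p ≤ℚ q → below ℐ q → below ℐ p
below-downward ℐ {p} {q} p≤q q<ℐ with ℚ.<-cmp p q
... | tri< p<q _ _  = ℝ.below-closed ℐ p<q q<ℐ
... | tri≈ _ refl _ = q<ℐ
... | tri> _ _ q<p  = contradiction (ℚ.<-≤-trans q<p p≤q) (ℚ.<-irrefl refl)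

below≤above : ∀ (ℐ : ℝ) {p q} → below ℐ p → above ℐ q → p ≤ℚ q
below≤above ℐ {p} {q} p<ℐ ℐ<q with ℚ.≤-total p q
... | inj₁ p≤q = p≤q
... | inj₂ q≤p = contradiction (p<ℐ , above-upward ℐ q≤p ℐ<q) (ℝ.disjoint ℐ)

-- If `r ≤ q`, openness gives some `q′` with `q < q′ < ℐ`. A term with `a n ≤ r` that is within
-- `q′ - q` of `ℐ` then puts `ℐ` below `q′`, a contradiction.
limit-≤ : ∀ (a : ℕ → ℚ) (ℐ : ℝ) {r} → a ⟶ ℐ → (∀ N → ∃ λ n → N ≤ℕ n × a n ≤ℚ r) → ℐ ≤ fromℚ r
limit-≤ a ℐ {r} a⟶ℐ a≤r q q<ℐ = ℚ.≰⇒> λ r≤q →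
  let (q′ , q<q′ , q′<ℐ) = ℝ.below-open ℐ q<ℐ
      (N , near)         = a⟶ℐ (q′ - q) (subst (_<ℚ q′ - q) (ℚ.+-inverseʳ q) (ℚ.+-monoˡ-< (- q) q<q′))
      (n , N≤n , aₙ≤r)   = a≤r N
      aₙ+ε≤q′            = subst (a n + (q′ - q) ≤ℚ_)
        (solve 2 (λ q q′ → q :+ (q′ :- q) := q′) refl q q′)
        (ℚ.+-monoˡ-≤ (q′ - q) (ℚ.≤-trans aₙ≤r r≤q))
  in ℝ.disjoint ℐ (q′<ℐ , above-upward ℐ aₙ+ε≤q′ (proj₂ (near n N≤n)))

-- Here `c` stands for n - k. The inequality `r ≤ i` keeps `r` from exceeding the limit by much.
-- Since consecutive values of `i` are nearly equal, the recurrence keeps `r` from falling far below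
-- it.
interpolated-⟶ : ∀ k c (i r : ℕ → ℚ) (ℐ : ℝ) .{{_ : NonZero k}} → i ⟶ ℐ → (∀ p → r (suc p) ≤ℚ i (suc p)) →
  (∀ p → ι (k +ℕ c) * i (suc (suc p)) ≤ℚ ι k * r (suc p) + ι c * i (suc p)) → r ⟶ ℐ
-- The threshold is raised by one so that every index considered is a successor, as the hypotheses
-- on `r` require. Matching `k` as a successor exposes `m` as nonzero.
interpolated-⟶ k@(suc _) c i r ℐ i⟶ℐ r≤i recurrence ε 0<ε = suc (proj₁ close) , bounds
  where
  -- This is the factor of `slack-estimate`, so with δ = ε / m the total loss is exactly ε.
  m = 2 *ℕ (k +ℕ c)
  δ = ε * (+ 1 / m)

  mδ≡ε : ι m * δ ≡ ε
  mδ≡ε = begin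
    ι m * (ε * (+ 1 / m))   ≡⟨ solve 3 (λ M E D → M :* (E :* D) := E :* (M :* D)) refl (ι m) ε (+ 1 / m) ⟩
    ε * (ι m * (+ 1 / m))   ≡⟨ cong (ε *_) (ι-*-/ 1 m) ⟩
    ε * ι 1                 ≡⟨ ℚ.*-identityʳ ε ⟩
    ε                       ∎
    where open ≡-Reasoning

  0<δ : 0ℚ <ℚ δ
  0<δ = ℚ.positive⁻¹ δ {{ℚ.pos*pos⇒pos ε {{positive 0<ε}} (+ 1 / m) {{ℚ.normalize-pos 1 m}}}}

  δ≤ε : δ ≤ℚ ε
  δ≤ε = subst₂ _≤ℚ_ (ℚ.*-identityˡ δ) mδ≡ε
    (ℚ.*-monoʳ-≤-nonNeg δ {{nonNegative (ℚ.<⇒≤ 0<δ)}} (ι-mono-≤ {1} {m} (s≤s z≤n)))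

  close = i⟶ℐ δ 0<δ

  bounds : ∀ n → suc (proj₁ close) ≤ℕ n → below ℐ (r n - ε) × above ℐ (r n + ε)
  bounds (suc p) (s≤s N≤p) =
    below-downward ℐ (ℚ.+-mono-≤ (r≤i p) (ℚ.neg-antimono-≤ δ≤ε)) i-δ<ℐ ,
    -- The values of `i` at two consecutive exponents are both within δ of `ℐ`, which `below≤above`
    -- turns into the closeness that `slack-estimate` needs.
    above-upward ℐ (subst (λ z → i (suc (suc p)) + δ ≤ℚ r (suc p) + z) mδ≡ε
      (slack-estimate k c (ℚ.<⇒≤ 0<δ) (below≤above ℐ i-δ<ℐ ℐ<i+δ) (recurrence p))) ℐ<i+δ
    where
    N≤1+p = ℕ.m≤n⇒m≤1+n N≤p
    i-δ<ℐ = proj₁ (proj₂ close (suc p) N≤1+p)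
    ℐ<i+δ = proj₂ (proj₂ close (suc (suc p)) (ℕ.m≤n⇒m≤1+n N≤1+p))

-- Ratios of the powers of a graph.

order-^□ : ∀ G p → order (G ^□ p) ≡ order G ^ p
order-^□ G 0             = refl
order-^□ G 1             = sym (ℕ.*-identityʳ (order G))
order-^□ G (suc (suc p)) = trans (ℕ.*-comm (order (G ^□ suc p)) (order G)) (cong (order G *ℕ_) (order-^□ G (suc p)))

module _ (G : Graph) (k : ℕ) .{{_ : NonZero k}} .{{_ : NonZero (order G)}} where

  powerRatio : ℕ → ℚ
  powerRatio p = independenceRatio (G ^□ p) {{^□-nonEmpty G p}}

  k*order-nonZero : ∀ p → NonZero (k *ℕ order (G ^□ p))
  k*order-nonZero p = ℕ.m*n≢0 k (order (G ^□ p)) {{it}} {{^□-nonEmpty G p}}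

  -- Writing the denominator with the order of the power itself lets both ratios be compared over
  -- related denominators.
  cliqueProductRatio-≡ : ∀ p →
    cliqueProductRatio G k p ≡ (+ α (G ^□ p □ complete k) / (k *ℕ order (G ^□ p))) {{k*order-nonZero p}}
  cliqueProductRatio-≡ p = ℚ./-cong {+ α (G ^□ p □ complete k)}
    {{ℕ.m*n≢0 k (order G ^ p) {{it}} {{ℕ.m^n≢0 (order G) p}}}} {{k*order-nonZero p}}
    refl (cong (k *ℕ_) (sym (order-^□ G p)))

  cliqueProductRatio≤powerRatio : ∀ p → cliqueProductRatio G k p ≤ℚ powerRatio p
  cliqueProductRatio≤powerRatio p = subst (_≤ℚ powerRatio p) (sym (cliqueProductRatio-≡ p))
    (+/-mono-≤ b a (k *ℕ N) N {{k*order-nonZero p}} {{^□-nonEmpty G p}} (begin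
      b *ℕ N            ≤⟨ ℕ.*-monoˡ-≤ N (α-□-≤ (G ^□ p) (complete k)) ⟩
      k *ℕ a *ℕ N       ≡⟨ trans (cong (_*ℕ N) (ℕ.*-comm k a)) (ℕ.*-assoc a k N) ⟩
      a *ℕ (k *ℕ N)     ∎))
    where
    open ℕ.≤-Reasoning
    a = α (G ^□ p)
    b = α (G ^□ p □ complete k)
    N = order (G ^□ p)

  -- The bound `α-□-□-≤` is applied with middle factor `G`. Exponents start at 1 because `_^□_`
  -- unfolds to a product with `G` only from exponent 2 on.
  cliqueProductRatio-antitone-step : ∀ p → cliqueProductRatio G k (suc (suc p)) ≤ℚ cliqueProductRatio G k (suc p)
  cliqueProductRatio-antitone-step p =
    subst₂ _≤ℚ_ (sym (cliqueProductRatio-≡ (suc (suc p)))) (sym (cliqueProductRatio-≡ (suc p)))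
      (+/-mono-≤ b′ b (k *ℕ (N *ℕ n)) (k *ℕ N) {{k*order-nonZero (suc (suc p))}} {{k*order-nonZero (suc p)}} (begin
        b′ *ℕ (k *ℕ N)            ≤⟨ ℕ.*-monoˡ-≤ (k *ℕ N) (α-□-□-≤ (G ^□ suc p) G (complete k)) ⟩
        n *ℕ b *ℕ (k *ℕ N)        ≡⟨ cong (_*ℕ (k *ℕ N)) (ℕ.*-comm n b) ⟩
        b *ℕ n *ℕ (k *ℕ N)        ≡⟨ ℕ.*-assoc b n (k *ℕ N) ⟩
        b *ℕ (n *ℕ (k *ℕ N))      ≡⟨ cong (b *ℕ_) (trans (ℕ.*-comm n (k *ℕ N)) (ℕ.*-assoc k N n)) ⟩
        b *ℕ (k *ℕ (N *ℕ n))      ∎))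
    where
    open ℕ.≤-Reasoning
    b′ = α (G ^□ suc (suc p) □ complete k)
    b  = α (G ^□ suc p □ complete k)
    N  = order (G ^□ suc p)
    n  = order G

  cliqueProductRatio-antitone : ∀ m p → cliqueProductRatio G k (suc (m +ℕ p)) ≤ℚ cliqueProductRatio G k (suc p)
  cliqueProductRatio-antitone zero    p = ℚ.≤-refl
  cliqueProductRatio-antitone (suc m) p =
    ℚ.≤-trans (cliqueProductRatio-antitone-step (m +ℕ p)) (cliqueProductRatio-antitone m p)

  powerRatio-recurrence : HasClique G k → ∀ p →
    ι (order G) * powerRatio (suc (suc p)) ≤ℚ
      ι k * cliqueProductRatio G k (suc p) + ι (order G ∸ℕ k) * powerRatio (suc p)
  powerRatio-recurrence K p =
    subst (λ r → ι (order G) * powerRatio (suc (suc p)) ≤ℚ ι k * r + ι (order G ∸ℕ k) * powerRatio (suc p))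
      (sym (cliqueProductRatio-≡ (suc p)))
      (quotient-recurrence (order G ∸ℕ k) k (order G) (order (G ^□ suc p))
        {{^□-nonEmpty G (suc p)}} {{k*order-nonZero (suc p)}} {{^□-nonEmpty G (suc (suc p))}}
        (α-□-clique-≤ (G ^□ suc p) G K))

-- Bound and limit for a graph containing a clique.

clique≤order : ∀ G {k} → HasClique G k → k ≤ℕ order G
clique≤order G (C , _ , refl) = ∣p∣≤n C

theorem1p3 :
    ∀ (k : ℕ) .{{_ : NonZero k}} (G : Graph) (K : HasClique G k) →
    let instance
          nonEmpty : NonZero (order G)
          nonEmpty = clique⇒nonEmpty G K
    in
    ∀ (ℐ : ℝ) → IsUltimateIndependenceRatio G ℐ →
      (∀ (ℓ : ℕ) .{{_ : NonZero ℓ}} → ℐ ≤ fromℚ (cliqueProductRatio G k ℓ))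
      × (λ ℓ → cliqueProductRatio G k ℓ) ⟶ ℐ
theorem1p3 k G K ℐ i⟶ℐ = upperBound , r⟶ℐ
  where
  instance
    nonEmpty : NonZero (order G)
    nonEmpty = clique⇒nonEmpty G K

  r⟶ℐ : (λ ℓ → cliqueProductRatio G k ℓ) ⟶ ℐ
  r⟶ℐ = interpolated-⟶ k (order G ∸ℕ k) (powerRatio G k) (λ ℓ → cliqueProductRatio G k ℓ) ℐ i⟶ℐ
    (λ p → cliqueProductRatio≤powerRatio G k (suc p))
    (λ p → subst (λ n → ι n * powerRatio G k (suc (suc p)) ≤ℚ
        ι k * cliqueProductRatio G k (suc p) + ι (order G ∸ℕ k) * powerRatio G k (suc p))
      -- A clique has at most `order G` vertices, so the truncated difference is a true one and k +
      -- (n - k) recovers n.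
      (sym (ℕ.m+[n∸m]≡n (clique≤order G K))) (powerRatio-recurrence G k K p))

  upperBound : ∀ (ℓ : ℕ) .{{_ : NonZero ℓ}} → ℐ ≤ fromℚ (cliqueProductRatio G k ℓ)
  upperBound (suc p) = limit-≤ (λ ℓ → cliqueProductRatio G k ℓ) ℐ r⟶ℐ λ N →
    -- This exponent is beyond both `N` and `suc p`, so monotonicity supplies arbitrarily late terms
    -- bounded by the ratio at `suc p`.
    suc (N +ℕ p) , ℕ.m≤n⇒m≤1+n (ℕ.m≤m+n N p) , cliqueProductRatio-antitone G k N p
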